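{- Let $t\geq 1$ be an integer. For every integer $h\geq 0$, every connected graph with treewidth at most $t-1$ has pathwidth at most $th+1$ or belongs to $\mathcal{T}_{h+1}$.
   Context: Graphs are finite, simple and undirected; a graph with no vertices is not connected. The classes $\mathcal{T}_h$ are defined inductively: $\mathcal{T}_0$ is the class of all connected graphs, and $\mathcal{T}_{h+1}$ is the class of connected graphs $G$ that contain three pairwise disjoint vertex sets $V_1,V_2,V_3$ such that $G[V_1],G[V_2],G[V_3]\in\mathcal{T}_h$ and for any two of $V_1,V_2,V_3$ there is a path in $G$ connecting them that avoids the third one. -}

module Defs where

open import Data.Nat using (ℕ; suc; _≤_)
open import Data.Bool using (Bool; true; false)
open import Data.Fin as Fin using (Fin)
open import Data.Fin.Subset as Sub using (Subset; _∈_; _∉_; _⊆_; _∩_; ∣_∣; Empty)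
open import Data.List using (List; _∷_; []; head; last; length)
open import Data.List.Relation.Unary.All using (All)
open import Data.List.Relation.Unary.Linked using (Linked)
open import Data.List.Relation.Unary.Unique.Propositional using (Unique)
open import Data.Maybe using (just)
open import Data.Product using (Σ; ∃; ∃₂; _×_)
open import Data.Unit using (⊤)
open import Relation.Binary.PropositionalEquality using (_≡_)
open import Relation.Nullary using (¬_)

record Graph : Set where
  field
    n     : ℕ
    adj   : Fin n → Fin n → Bool
    sym   : ∀ u v → adj u v ≡ adj v u
    irrefl : ∀ v → adj v v ≡ false

open Graph public

Adj : (G : Graph) → Fin (n G) → Fin (n G) → Set
Adj G u v = adj G u v ≡ true

V : (G : Graph) → Subset (n G)
V G = Sub.⊤

IsPathIn : (G : Graph) → (Fin (n G) → Set) → List (Fin (n G)) → Set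
IsPathIn G P ps = Linked (Adj G) ps × All P ps × Unique ps

PathIn : (G : Graph) → (Fin (n G) → Set) → Fin (n G) → Fin (n G) → Set
PathIn G P u v = Σ (List (Fin (n G))) λ ps →
  IsPathIn G P ps × head ps ≡ just u × last ps ≡ just v

ConnectedIn : (G : Graph) → (Fin (n G) → Set) → Set
ConnectedIn G P = (∃ λ v → P v) × (∀ u v → P u → P v → PathIn G P u v)

Connected : Graph → Set
Connected G = ConnectedIn G (λ _ → ⊤)

HasCycle : Graph → Set
HasCycle G = Σ (List (Fin (n G))) λ ps →
  3 ≤ length ps × Linked (Adj G) ps × Unique ps ×
  ∃₂ λ a b → head ps ≡ just a × last ps ≡ just b × Adj G b a

IsTree : Graph → Set
IsTree T = Connected T × ¬ HasCycle T

record TreeDecomposition (G : Graph) : Set where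
  field
    T        : Graph
    tree     : IsTree T
    bag      : Fin (n T) → Subset (n G)
    cover    : ∀ v → ∃ λ i → v ∈ bag i
    edges    : ∀ u v → Adj G u v → ∃ λ i → u ∈ bag i × v ∈ bag i
    coherent : ∀ v → ConnectedIn T (λ i → v ∈ bag i)

TreewidthAtMost : Graph → ℕ → Set
TreewidthAtMost G k = Σ (TreeDecomposition G) λ D →
  ∀ i → ∣ TreeDecomposition.bag D i ∣ ≤ suc k

record PathDecomposition (G : Graph) : Set where
  field
    m        : ℕ
    bag      : Fin m → Subset (n G)
    cover    : ∀ v → ∃ λ i → v ∈ bag i
    edges    : ∀ u v → Adj G u v → ∃ λ i → u ∈ bag i × v ∈ bag i
    interval : ∀ v (i j k : Fin m) → i Fin.≤ j → j Fin.≤ k →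
               v ∈ bag i → v ∈ bag k → v ∈ bag j

PathwidthAtMost : Graph → ℕ → Set
PathwidthAtMost G k = Σ (PathDecomposition G) λ D →
  ∀ i → ∣ PathDecomposition.bag D i ∣ ≤ suc k

-- The classes T_h, for induced subgraphs G[S] (S ⊆ V(G)).
-- InT h G S  means  G[S] ∈ T_h.  (G[S][W] = G[W] for W ⊆ S.)

LinkAvoiding : (G : Graph) → (S A B C : Subset (n G)) → Set
LinkAvoiding G S A B C = ∃₂ λ a b → a ∈ A × b ∈ B ×
  PathIn G (λ x → x ∈ S × x ∉ C) a b

InT : ℕ → (G : Graph) → Subset (n G) → Set
InT 0 G S = ConnectedIn G (_∈ S)
InT (suc h) G S = ConnectedIn G (_∈ S) ×
  Σ (Subset (n G)) λ V₁ → Σ (Subset (n G)) λ V₂ → Σ (Subset (n G)) λ V₃ →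
    (V₁ ⊆ S × V₂ ⊆ S × V₃ ⊆ S) ×
    (Empty (V₁ ∩ V₂) × Empty (V₁ ∩ V₃) × Empty (V₂ ∩ V₃)) ×
    (InT h G V₁ × InT h G V₂ × InT h G V₃) ×
    (LinkAvoiding G S V₁ V₂ V₃ × LinkAvoiding G S V₁ V₃ V₂ ×
     LinkAvoiding G S V₂ V₃ V₁)

InClassT : ℕ → Graph → Set
InClassT h G = InT h G (V G)

{-# OPTIONS --safe #-}
module Submission where

open import Defs
open import Data.Nat using (ℕ; suc; _≤_; _*_; _+_; _∸_)
open import Data.Sum using (_⊎_)

open import Data.Bool using (true)
import Data.Bool.Properties as Bool
open import Data.Empty using (⊥; ⊥-elim)
open import Data.Fin as Fin using (Fin; zero; suc)
open import Data.Fin.Properties using (_≟_; any?)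
open import Data.Fin.Subset using (Subset; _∈_; _∉_; _⊆_; _⊃_; _∩_; _∪_; _─_; ∣_∣; ⁅_⁆; Nonempty; inside; outside) renaming (⊥ to ∅)
open import Data.Fin.Subset.Induction using (⊃-wellFounded)
open import Data.Fin.Subset.Properties
open import Data.List using (List; []; _∷_; _++_; last; length; map; lookup; allFin)
open import Data.List.Membership.Propositional using () renaming (_∈_ to _∈ᴸ_)
open import Data.List.Membership.Propositional.Properties using (∈-allFin)
open import Data.List.Relation.Unary.All as All using (All; []; _∷_)
import Data.List.Relation.Unary.All.Properties as All
open import Data.List.Relation.Unary.AllPairs using ([]; _∷_)
open import Data.List.Relation.Unary.Any as Any using (Any; here; there)
import Data.List.Relation.Unary.Any.Properties as Any
open import Data.List.Relation.Unary.Linked using (Linked; []; [-]; _∷_)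
open import Data.List.Relation.Unary.Unique.Propositional using (Unique)
open import Data.Maybe using (just)
open import Data.Nat using (zero; _<_; z≤n; s≤s)
import Data.Nat.Properties as ℕ
open import Data.Product using (Σ; ∃; _×_; _,_; proj₁; proj₂)
open import Data.Sum using (inj₁; inj₂; [_,_]′)
import Data.Sum as Sum
open import Data.Unit using (⊤; tt)
open import Data.Vec using (tabulate; []; _∷_; here; there)
open import Data.Vec.Properties using (lookup∘tabulate; []=⇒lookup; lookup⇒[]=)
open import Function using (_∘_; id; case_of_)
open import Induction.WellFounded using (Acc; acc)
open import Relation.Binary.PropositionalEquality using (_≡_; _≢_; refl; trans; cong; subst) renaming (sym to ≡-sym)
open import Relation.Nullary using (¬_; yes; no; does; contradiction)
open import Relation.Nullary.Decidable using (_×-dec_; _⊎-dec_; ¬?; dec-true)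
open import Relation.Unary using (Decidable)

-- Induct on h; call a connected vertex set heavy if it is in T_h, so that the light ones have small pathwidth by
-- induction. Given a bag B, a heavy component E of G - B and a vertex q outside E, let near q E consist of E and
-- everything that E separates from q. If two heavy components on the same side of a heavy connected set H ∋ q do
-- not separate each other from q, then they form a T_{h+1} structure together with H. Otherwise one component E
-- has all the heavy ones inside near q E, so one can output the bag B without near q E, glue the light components
-- outside near q E to it, and continue inside near q E. The bags used need not follow a path of the decomposition
-- tree: all that is needed is that a connected set whose boundary lies in a tree bag has its boundary in another
-- tree bag that meets the set. Starting from an H at one end, this yields a path decomposition with bags of size t
-- plus those of the light pieces. For h = 0 there are no light sets, and the edges of G serve as bags: either the
-- boundary of a connected set inside an edge has at most one vertex, or there is a T_1 structure.

-- Finite subsets and lexicographic induction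

∈─⇒∉ : ∀ {m} {x : Fin m} (p q : Subset m) → x ∈ p ─ q → x ∉ q
∈─⇒∉ (_ ∷ p) (inside ∷ q) (there x∈) (there x∈q) = ∈─⇒∉ p q x∈ x∈q
∈─⇒∉ (_ ∷ p) (outside ∷ q) (there x∈) (there x∈q) = ∈─⇒∉ p q x∈ x∈q

∣p∪q∣≤∣p∣+∣q∣ : ∀ {m} (p q : Subset m) → ∣ p ∪ q ∣ ≤ ∣ p ∣ + ∣ q ∣
∣p∪q∣≤∣p∣+∣q∣ [] [] = z≤n
∣p∪q∣≤∣p∣+∣q∣ (inside ∷ p) (inside ∷ q) =
  s≤s (ℕ.≤-trans (∣p∪q∣≤∣p∣+∣q∣ p q) (ℕ.+-monoʳ-≤ ∣ p ∣ (ℕ.n≤1+n ∣ q ∣)))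
∣p∪q∣≤∣p∣+∣q∣ (inside ∷ p) (outside ∷ q) = s≤s (∣p∪q∣≤∣p∣+∣q∣ p q)
∣p∪q∣≤∣p∣+∣q∣ (outside ∷ p) (inside ∷ q) =
  ℕ.≤-trans (s≤s (∣p∪q∣≤∣p∣+∣q∣ p q)) (ℕ.≤-reflexive (≡-sym (ℕ.+-suc ∣ p ∣ ∣ q ∣)))
∣p∪q∣≤∣p∣+∣q∣ (outside ∷ p) (outside ∷ q) = ∣p∪q∣≤∣p∣+∣q∣ p q

module _ {m} {P : Fin m → Set} (P? : Decidable P) where

  comprehension : Subset m
  comprehension = tabulate (does ∘ P?)

  ∈-comprehension⁺ : ∀ {x} → P x → x ∈ comprehension
  ∈-comprehension⁺ {x} px =
    lookup⇒[]= x _ (trans (lookup∘tabulate (does ∘ P?) x) (dec-true (P? x) px))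

  ∈-comprehension⁻ : ∀ {x} → x ∈ comprehension → P x
  ∈-comprehension⁻ {x} x∈ with P? x | trans (≡-sym (lookup∘tabulate (does ∘ P?) x)) ([]=⇒lookup x∈)
  ... | yes px | _ = px
  ... | no _ | ()

find⊎all : ∀ {m} {A B : Fin m → Set} → (∀ i → A i ⊎ B i) → ∃ A ⊎ (∀ i → B i)
find⊎all {zero} f = inj₂ λ ()
find⊎all {suc m} f with f zero | find⊎all (f ∘ suc)
... | inj₁ a | _ = inj₁ (zero , a)
... | inj₂ _ | inj₁ (i , a) = inj₁ (suc i , a)
... | inj₂ b | inj₂ bs = inj₂ λ { zero → b ; (suc i) → bs i }

-- The second measure may grow when the first drops, so its bound `d` is then set afresh to
-- `suc (g b)`; otherwise the bound `r` on the first measure is kept.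
lex-induction : ∀ {A : Set} (f g : A → ℕ) (P : A → Set) →
                (∀ a → (∀ b → f b < f a ⊎ (f b ≤ f a × g b < g a) → P b) → P a) → ∀ a → P a
lex-induction f g P rec a = go (suc (f a)) (suc (g a)) a ℕ.≤-refl ℕ.≤-refl
  where
  go : ∀ r d a → f a < r → g a < d → P a
  go (suc r) (suc d) a <r <d = rec a λ b →
    [ (λ fb<fa → go r (suc (g b)) b (ℕ.<-≤-trans fb<fa (ℕ.≤-pred <r)) ℕ.≤-refl)
    , (λ (fb≤fa , gb<ga) → go (suc r) d b (ℕ.≤-<-trans fb≤fa <r) (ℕ.<-≤-trans gb<ga (ℕ.≤-pred <d))) ]′

-- Walks and components

module Walks (G : Graph) where

  Vertex : Set
  Vertex = Fin (n G)

  Adj-sym : ∀ {u v} → Adj G u v → Adj G v u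
  Adj-sym {u} {v} a = trans (sym G v u) a

  data Walk (P : Vertex → Set) : Vertex → Vertex → Set where
    stop : ∀ {u} → P u → Walk P u u
    step : ∀ {u w v} → P u → Adj G u w → Walk P w v → Walk P u v

  module _ {P : Vertex → Set} where

    walk-source : ∀ {u v} → Walk P u v → P u
    walk-source (stop p) = p
    walk-source (step p _ _) = p

    infixr 5 _◅◅_
    _◅◅_ : ∀ {u v w} → Walk P u v → Walk P v w → Walk P u w
    stop _ ◅◅ ω = ω
    step p a ω′ ◅◅ ω = step p a (ω′ ◅◅ ω)

    reverse : ∀ {u v} → Walk P u v → Walk P v u
    reverse (stop p) = stop p
    reverse (step p a ω) = reverse ω ◅◅ step (walk-source ω) (Adj-sym a) (stop p)

    transport : ∀ (Q : Vertex → Set) → (∀ {u w} → Q u → P w → Adj G u w → Q w) →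
                ∀ {u v} → Walk P u v → Q u → Q v
    transport Q f (stop _) q = q
    transport Q f (step _ a ω) q = transport Q f ω (f q (walk-source ω) a)

  walk-map : ∀ {P Q : Vertex → Set} → (∀ {x} → P x → Q x) → ∀ {u v} → Walk P u v → Walk Q u v
  walk-map f (stop p) = stop (f p)
  walk-map f (step p a ω) = step (f p) a (walk-map f ω)

  module _ {P : Vertex → Set} where

    list→walk : ∀ {u v} ps → Linked (Adj G) (u ∷ ps) → All P (u ∷ ps) →
                last (u ∷ ps) ≡ just v → Walk P u v
    list→walk [] _ (p ∷ []) refl = stop p
    list→walk (w ∷ ps) (a ∷ as) (p ∷ all) l = step p a (list→walk ps as all l)

    path→walk : ∀ {u v} → PathIn G P u v → Walk P u v
    path→walk (u ∷ ps , (as , all , _) , refl , l) = list→walk ps as all l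

    suffix : ∀ {u v} ps → IsPathIn G P ps → last ps ≡ just v → u ∈ᴸ ps → PathIn G P u v
    suffix (x ∷ ps) path l (here refl) = x ∷ ps , path , refl , l
    suffix (x ∷ y ∷ ps) (_ ∷ as , _ ∷ all , _ ∷ uniq) l (there i) = suffix (y ∷ ps) (as , all , uniq) l i

    -- Loop erasure: if the new source already lies on the path, the part before it is dropped.
    walk→path : ∀ {u v} → Walk P u v → PathIn G P u v
    walk→path (stop p) = _ ∷ [] , ([-] , p ∷ [] , [] ∷ []) , refl , refl
    walk→path (step {u} p a ω) with walk→path ω
    ... | y ∷ ps , (as , all , uniq) , refl , l with Any.any? (u ≟_) (y ∷ ps)
    ...   | yes i = suffix (y ∷ ps) (as , all , uniq) l i
    ...   | no ∉ = u ∷ y ∷ ps , (a ∷ as , p ∷ all , All.¬Any⇒All¬ _ ∉ ∷ uniq) , refl , l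

  Conn : Subset (n G) → Set
  Conn S = ∀ {u v} → u ∈ S → v ∈ S → Walk (_∈ S) u v

  connectedIn : ∀ {S} → Nonempty S → Conn S → ConnectedIn G (_∈ S)
  connectedIn ne c = ne , λ _ _ u∈ v∈ → walk→path (c u∈ v∈)

  private
    grow : ∀ S u A → Acc _⊃_ A → u ∈ A → (∀ {v} → v ∈ A → Walk (_∈ S) u v) →
           Σ (Subset (n G)) λ C → u ∈ C × (∀ {v} → v ∈ C → Walk (_∈ S) u v) ×
             (∀ {v w} → v ∈ C → w ∈ S → Adj G v w → w ∈ C)
    grow S u A (acc rec) u∈ reach
      with any? (λ w → (w ∈? S) ×-dec ¬? (w ∈? A) ×-dec any? (λ v → (v ∈? A) ×-dec (adj G v w Bool.≟ true)))
    ... | yes (w , w∈S , w∉A , v , v∈A , a) =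
      grow S u (A ∪ ⁅ w ⁆)
        (rec (p⊆p∪q ⁅ w ⁆ , w , q⊆p∪q A ⁅ w ⁆ (x∈⁅x⁆ w) , w∉A))
        (p⊆p∪q ⁅ w ⁆ u∈)
        λ x∈ → case x∈p∪q⁻ A ⁅ w ⁆ x∈ of λ where
          (inj₁ x∈A) → reach x∈A
          (inj₂ x∈w) → subst (Walk (_∈ S) u) (≡-sym (x∈⁅y⁆⇒x≡y w x∈w)) (reach v∈A ◅◅ step (target (reach v∈A)) a (stop w∈S))
      where
      target : ∀ {x y} → Walk (_∈ S) x y → y ∈ S
      target ω = walk-source (reverse ω)
    ... | no stuck = A , u∈ , reach , λ {v} {w} v∈ w∈S a → case w ∈? A of λ where
      (yes w∈) → w∈
      (no w∉) → contradiction (w , w∈S , w∉ , v , v∈ , a) stuck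

    component : ∀ S u → Σ (Subset (n G)) λ C →
                (∀ {v} → v ∈ C → Walk (_∈ S) u v) × (∀ {v} → Walk (_∈ S) u v → v ∈ C)
    component S u with u ∈? S
    ... | no u∉ = ∅ , (λ v∈ → contradiction v∈ ∉⊥) , λ ω → contradiction (walk-source ω) u∉
    ... | yes u∈S with grow S u ⁅ u ⁆ (⊃-wellFounded _) (x∈⁅x⁆ u)
                        (λ v∈ → subst (Walk (_∈ S) u) (≡-sym (x∈⁅y⁆⇒x≡y u v∈)) (stop u∈S))
    ...   | C , u∈ , reach , closed = C , reach , λ ω → transport (_∈ C) closed ω u∈

  abstract
    comp : Subset (n G) → Vertex → Subset (n G)
    comp S u = proj₁ (component S u)

    comp⁻ : ∀ {S u v} → v ∈ comp S u → Walk (_∈ S) u v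
    comp⁻ {S} {u} = proj₁ (proj₂ (component S u))

    comp⁺ : ∀ {S u v} → Walk (_∈ S) u v → v ∈ comp S u
    comp⁺ {S} {u} = proj₂ (proj₂ (component S u))

  comp-⊆ : ∀ {S u} → comp S u ⊆ S
  comp-⊆ v∈ = walk-source (reverse (comp⁻ v∈))

  comp-closed : ∀ {S u v w} → v ∈ comp S u → w ∈ S → Adj G v w → w ∈ comp S u
  comp-closed v∈ w∈S a = comp⁺ (comp⁻ v∈ ◅◅ step (comp-⊆ v∈) a (stop w∈S))

  comp-walk : ∀ {S u v} → v ∈ comp S u → Walk (_∈ comp S u) u v
  comp-walk {S} {u} v∈ = lift (comp⁻ v∈) (comp⁺ (stop (walk-source (comp⁻ v∈))))
    where
    lift : ∀ {a b} → Walk (_∈ S) a b → a ∈ comp S u → Walk (_∈ comp S u) a b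
    lift (stop _) a∈ = stop a∈
    lift (step _ a ω) a∈ = step a∈ a (lift ω (comp-closed a∈ (walk-source ω) a))

  comp-conn : ∀ {S u} → Conn (comp S u)
  comp-conn v∈ w∈ = reverse (comp-walk v∈) ◅◅ comp-walk w∈

  conn⊆comp : ∀ {S u A} → Conn A → A ⊆ S → ∀ {a} → a ∈ A → a ∈ comp S u → A ⊆ comp S u
  conn⊆comp c A⊆S a∈A a∈ b∈A = comp⁺ (comp⁻ a∈ ◅◅ walk-map A⊆S (c a∈A b∈A))

  -- The closing edge of the cycle runs through x.
  tree-branch-unique : ¬ HasCycle G → ∀ {x y y′} → Adj G x y → Adj G x y′ →
                       Walk (x ≢_) y y′ → y ≡ y′
  tree-branch-unique acyclic {x} {y} {y′} a a′ ω with y ≟ y′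
  ... | yes y≡y′ = y≡y′
  ... | no y≢y′ with walk→path ω
  ...   | y ∷ [] , _ , refl , refl = contradiction refl y≢y′
  ...   | y ∷ z ∷ ps , (as , all , uniq) , refl , l =
    contradiction (x ∷ y ∷ z ∷ ps , s≤s (s≤s (s≤s z≤n)) , a ∷ as , all ∷ uniq , x , y′ , refl , l , Adj-sym a′) acyclic

-- Path decompositions as lists of bags

module Sweeps (G : Graph) where
  open Walks G

  Covers : List (Subset (n G)) → Vertex → Set
  Covers Bs v = Any (v ∈_) Bs

  Joins : List (Subset (n G)) → Vertex → Vertex → Set
  Joins Bs u v = Any (λ B → u ∈ B × v ∈ B) Bs

  InFirst : List (Subset (n G)) → Vertex → Set
  InFirst [] v = ⊥
  InFirst (B ∷ _) v = v ∈ B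

  -- The interval condition in local form: a vertex that recurs later must already be in the next
  -- bag. This can be checked bag by bag when lists are joined.
  Contiguous : List (Subset (n G)) → Set
  Contiguous [] = ⊤
  Contiguous (B ∷ Bs) = (∀ {v} → v ∈ B → Covers Bs v → InFirst Bs v) × Contiguous Bs

  first⇒covers : ∀ Bs {v} → InFirst Bs v → Covers Bs v
  first⇒covers (B ∷ _) v∈ = here v∈

  first⇒joins : ∀ Bs {u v} → InFirst Bs u → InFirst Bs v → Joins Bs u v
  first⇒joins (B ∷ _) u∈ v∈ = here (u∈ , v∈)

  joins-sym : ∀ {Bs u v} → Joins Bs u v → Joins Bs v u
  joins-sym = Any.map λ (u∈ , v∈) → v∈ , u∈

  -- A vertex shared by both lists has to bridge the seam, so it is required throughout `As` and in
  -- the first bag of `Bs`.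
  contiguous-++ : ∀ As {Bs} → Contiguous As → Contiguous Bs →
                  (∀ {v} → Covers As v → Covers Bs v → All (v ∈_) As × InFirst Bs v) →
                  Contiguous (As ++ Bs)
  contiguous-++ [] _ cB _ = cB
  contiguous-++ (A ∷ []) _ cB meet = (λ v∈ v∈Bs → proj₂ (meet (here v∈) v∈Bs)) , cB
  contiguous-++ (A ∷ A′ ∷ As) (cA , cAs) cB meet =
    (λ v∈ c → case Any.++⁻ (A′ ∷ As) c of λ where
      (inj₁ v∈As) → cA v∈ v∈As
      (inj₂ v∈Bs) → All.head (All.tail (proj₁ (meet (here v∈) v∈Bs)))) ,
    contiguous-++ (A′ ∷ As) cAs cB
      λ v∈As v∈Bs → let all , f = meet (there v∈As) v∈Bs in All.tail all , f

  module _ (M : Subset (n G)) where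

    widen : List (Subset (n G)) → List (Subset (n G))
    widen = map (M ∪_)

    covers-widen⁻ : ∀ Ls {v} → Covers (widen Ls) v → v ∈ M ⊎ Covers Ls v
    covers-widen⁻ (L ∷ Ls) (here v∈) = Sum.map id here (x∈p∪q⁻ M L v∈)
    covers-widen⁻ (L ∷ Ls) (there v∈) = Sum.map id there (covers-widen⁻ Ls v∈)

    covers-widen⁺ : ∀ {Ls v} → Covers Ls v → Covers (widen Ls) v
    covers-widen⁺ = Any.map⁺ ∘ Any.map (λ {L} → q⊆p∪q M L)

    all-widen : ∀ Ls {v} → v ∈ M → All (v ∈_) (widen Ls)
    all-widen Ls v∈ = All.map⁺ (All.universal (λ L → p⊆p∪q L v∈) Ls)

    contiguous-widen : ∀ Ls → Contiguous Ls → Contiguous (widen Ls)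
    contiguous-widen [] _ = tt
    contiguous-widen (L ∷ Ls) (c , cs) = first Ls c , contiguous-widen Ls cs
      where
      first : ∀ Ls → (∀ {v} → v ∈ L → Covers Ls v → InFirst Ls v) →
              ∀ {v} → v ∈ M ∪ L → Covers (widen Ls) v → InFirst (widen Ls) v
      first (L′ ∷ Ls) c v∈ cov with x∈p∪q⁻ M L v∈ | covers-widen⁻ (L′ ∷ Ls) cov
      ... | inj₁ v∈M | _ = p⊆p∪q L′ v∈M
      ... | inj₂ _ | inj₁ v∈M = p⊆p∪q L′ v∈M
      ... | inj₂ v∈L | inj₂ v∈Ls = q⊆p∪q M L′ (c v∈L v∈Ls)

  -- A path decomposition of Z together with some vertices F outside Z, all of them in the first bag,
  -- through which it is glued to the rest of U.
  record Sweep (U : Subset (n G)) (k : ℕ) (Z : Subset (n G)) (F : Vertex → Set) : Set where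
    field
      bags       : List (Subset (n G))
      small      : All (λ B → ∣ B ∣ ≤ k) bags
      contiguous : Contiguous bags
      cover      : ∀ {v} → v ∈ Z → Covers bags v
      within     : ∀ {v} → Covers bags v → v ∈ Z ⊎ F v
      front      : ∀ {v} → Covers bags v → v ∉ Z → InFirst bags v
      edge       : ∀ {u w} → u ∈ Z → w ∈ U → Adj G u w → Joins bags u w

  empty-sweep : ∀ {U k F} → Sweep U k ∅ F
  empty-sweep = record
    { bags = [] ; small = [] ; contiguous = tt
    ; cover = λ v∈ → contradiction v∈ ∉⊥ ; within = λ () ; front = λ ()
    ; edge = λ u∈ → contradiction u∈ ∉⊥ }

  sweep-mono : ∀ {U k k′ Z} {F F′ : Vertex → Set} → k ≤ k′ → (∀ {v} → v ∉ Z → F v → F′ v) →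
               Sweep U k Z F → Sweep U k′ Z F′
  sweep-mono {Z = Z} k≤k′ f S = record
    { Sweep S hiding (small; within)
    ; small = All.map (λ le → ℕ.≤-trans le k≤k′) (Sweep.small S)
    ; within = λ {v} c → case v ∈? Z of λ where
        (yes v∈) → inj₁ v∈
        (no v∉) → Sum.map id (f v∉) (Sweep.within S c) }

  lookup⇒covers : ∀ Bs {v} (i : Fin (length Bs)) → v ∈ lookup Bs i → Covers Bs v
  lookup⇒covers (B ∷ Bs) zero v∈ = here v∈
  lookup⇒covers (B ∷ Bs) (suc i) v∈ = there (lookup⇒covers Bs i v∈)

  contiguous-lookup : ∀ Bs → Contiguous Bs → ∀ {v} (i j k : Fin (length Bs)) → i Fin.≤ j → j Fin.≤ k →
                      v ∈ lookup Bs i → v ∈ lookup Bs k → v ∈ lookup Bs j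
  contiguous-lookup (B ∷ Bs) c zero zero k _ _ v∈i _ = v∈i
  contiguous-lookup (B ∷ B′ ∷ Bs) (c , cs) zero (suc j) (suc k) _ (s≤s j≤k) v∈i v∈k =
    contiguous-lookup (B′ ∷ Bs) cs zero j k z≤n j≤k (c v∈i (lookup⇒covers (B′ ∷ Bs) k v∈k)) v∈k
  contiguous-lookup (B ∷ Bs) (c , cs) (suc i) (suc j) (suc k) (s≤s i≤j) (s≤s j≤k) v∈i v∈k =
    contiguous-lookup Bs cs i j k i≤j j≤k v∈i v∈k

  sweep→pathwidth : ∀ {k F} → Sweep (V G) (suc k) (V G) F → PathwidthAtMost G k
  sweep→pathwidth S = record
    { m = length bags
    ; bag = lookup bags
    ; cover = λ v → Any.index (cover (∈⊤ {x = v})) , Any.lookup-index (cover (∈⊤ {x = v}))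
    ; edges = λ u v a → let e = edge (∈⊤ {x = u}) (∈⊤ {x = v}) a in Any.index e , Any.lookup-index e
    ; interval = λ v → contiguous-lookup bags contiguous }
    , λ i → All.lookup small (lookup∈ bags i)
    where
    open Sweep S
    lookup∈ : ∀ {A : Set} (xs : List A) i → lookup xs i ∈ᴸ xs
    lookup∈ (x ∷ xs) zero = here refl
    lookup∈ (x ∷ xs) (suc i) = there (lookup∈ xs i)

-- Regions and their separators inside a connected vertex set

module Regions (G : Graph) (U : Subset (n G)) where
  open Walks G
  open Sweeps G

  Region : Subset (n G) → Set
  Region D = D ⊆ U × Nonempty D × Conn D

  Boundary : Subset (n G) → Vertex → Set
  Boundary D w = w ∈ U × w ∉ D × ∃ λ d → d ∈ D × Adj G d w

  boundary? : ∀ D → Decidable (Boundary D)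
  boundary? D w = (w ∈? U) ×-dec ¬? (w ∈? D) ×-dec any? λ d → (d ∈? D) ×-dec (adj G d w Bool.≟ true)

  -- `nearby` keeps the bag free of vertices away from `D`, so that it can be glued along the
  -- boundary; `advance` makes it meet `D`, so that passing to a piece near `D` is progress.
  record Separator (Small : Subset (n G) → Set) (D : Subset (n G)) : Set where
    field
      bag     : Subset (n G)
      small   : Small bag
      guards  : ∀ {w} → Boundary D w → w ∈ bag
      nearby  : ∀ {w} → w ∈ bag → w ∈ D ⊎ Boundary D w
      advance : ∃ λ d → d ∈ D × d ∈ bag

  Anchored : (Subset (n G) → Set) → Subset (n G) → Set
  Anchored Small D = ∃ λ B → Small B × (∀ {w} → Boundary D w → w ∈ B)

  piece : Subset (n G) → Vertex → Subset (n G)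
  piece B v = comp (U ─ B) v

  far : Vertex → Subset (n G) → Subset (n G)
  far q D = comp (U ─ D) q

  -- D together with everything that D separates from q.
  near : Vertex → Subset (n G) → Subset (n G)
  near q D = U ─ far q D

  -- The size of `near q D` comes first. The size of the region itself decides when the new region
  -- lies inside the old one, for then the near set need not shrink.
  _≺[_]_ : Subset (n G) → Vertex → Subset (n G) → Set
  E ≺[ q ] D = ∣ near q E ∣ < ∣ near q D ∣ ⊎ (∣ near q E ∣ ≤ ∣ near q D ∣ × ∣ E ∣ < ∣ D ∣)

  module _ {B : Subset (n G)} where

    piece⊆U : ∀ {v} → piece B v ⊆ U
    piece⊆U x∈ = p─q⊆p U B (comp-⊆ x∈)

    piece∌B : ∀ {v x} → x ∈ piece B v → x ∉ B
    piece∌B x∈ = ∈─⇒∉ U B (comp-⊆ x∈)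

    v∈piece : ∀ {v} → v ∈ U → v ∉ B → v ∈ piece B v
    v∈piece v∈ v∉ = comp⁺ (stop (x∈p∧x∉q⇒x∈p─q v∈ v∉))

    piece-region : ∀ {v} → v ∈ U → v ∉ B → Region (piece B v)
    piece-region v∈ v∉ = piece⊆U , (_ , v∈piece v∈ v∉) , comp-conn

    piece-guards : ∀ {v w} → Boundary (piece B v) w → w ∈ B
    piece-guards {w = w} (w∈U , w∉ , d , d∈ , a) with w ∈? B
    ... | yes w∈B = w∈B
    ... | no w∉B = contradiction (comp-closed d∈ (x∈p∧x∉q⇒x∈p─q w∈U w∉B) a) w∉

    piece⊆ : ∀ {Z : Subset (n G)} → (∀ {u w} → u ∈ Z → u ∉ B → w ∈ U → w ∉ B → Adj G u w → w ∈ Z) →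
             ∀ {v} → v ∈ Z → piece B v ⊆ Z
    piece⊆ {Z} closed v∈Z x∈ = go (comp⁻ x∈) v∈Z
      where
      go : ∀ {u x} → Walk (_∈ U ─ B) u x → u ∈ Z → x ∈ Z
      go (stop _) u∈ = u∈
      go (step p a ω) u∈ = go ω (closed u∈ (∈─⇒∉ U B p)
        (p─q⊆p U B (walk-source ω)) (∈─⇒∉ U B (walk-source ω)) a)

  -- A walk within `E` that starts in `D` could leave `D` only through a boundary vertex, which
  -- would lie in `B`, and `E` avoids `B`.
  guarded⊆ : ∀ {B D E} → Region E → (∀ {w} → Boundary D w → w ∈ B) → (∀ {x} → x ∈ E → x ∉ B) →
             ∀ {a} → a ∈ E → a ∈ D → E ⊆ D
  guarded⊆ {B} {D} {E} (E⊆U , _ , E-conn) guards E∌B a∈E a∈D x∈E = transport (_∈ D) inD (E-conn a∈E x∈E) a∈D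
    where
    inD : ∀ {u w} → u ∈ D → w ∈ E → Adj G u w → w ∈ D
    inD {u} {w} u∈D w∈E a with w ∈? D
    ... | yes w∈D = w∈D
    ... | no w∉D = contradiction (guards (E⊆U w∈E , w∉D , u , u∈D , a)) (E∌B w∈E)

  module _ (q : Vertex) where

    far⊆U : ∀ D → far q D ⊆ U
    far⊆U D x∈ = p─q⊆p U D (comp-⊆ x∈)

    far∌D : ∀ D {x} → x ∈ far q D → x ∉ D
    far∌D D x∈ = ∈─⇒∉ U D (comp-⊆ x∈)

    near⊆U : ∀ D → near q D ⊆ U
    near⊆U D = p─q⊆p U (far q D)

    near∌far : ∀ D {x} → x ∈ near q D → x ∉ far q D
    near∌far D = ∈─⇒∉ U (far q D)

    near⁺ : ∀ D {x} → x ∈ U → x ∉ far q D → x ∈ near q D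
    near⁺ D = x∈p∧x∉q⇒x∈p─q

    D⊆near : ∀ {D} → D ⊆ U → D ⊆ near q D
    D⊆near {D} D⊆U x∈ = near⁺ D (D⊆U x∈) λ x∈far → far∌D D x∈far x∈

    far-closed : ∀ D {x w} → x ∈ far q D → w ∈ U → w ∉ D → Adj G x w → w ∈ far q D
    far-closed D x∈ w∈U w∉D a = comp-closed x∈ (x∈p∧x∉q⇒x∈p─q w∈U w∉D) a

    -- An edge from `near q D` to the far side must start in `D`: otherwise its start would itself
    -- be reachable from `q` off `D`.
    near-closed : ∀ D {u w} → u ∈ near q D → w ∈ U → Adj G u w → w ∈ near q D ⊎ Boundary D w
    near-closed D {u} {w} u∈ w∈U a with w ∈? far q D
    ... | no w∉ = inj₁ (near⁺ D w∈U w∉)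
    ... | yes w∈ with u ∈? D
    ...   | yes u∈D = inj₂ (w∈U , far∌D D w∈ , u , u∈D , a)
    ...   | no u∉D = contradiction (far-closed D w∈ (near⊆U D u∈) u∉D (Adj-sym a)) (near∌far D u∈)

    far-mono : ∀ {D E} → (∀ {x} → x ∈ E → x ∉ far q D) → far q D ⊆ far q E
    far-mono {D} {E} E∌far x∈ =
      comp⁺ (walk-map (λ y∈ → x∈p∧x∉q⇒x∈p─q (far⊆U D y∈) λ y∈E → E∌far y∈E y∈) (comp-walk x∈))

    near-mono : ∀ {D E} → (∀ {x} → x ∈ E → x ∉ far q D) → near q E ⊆ near q D
    near-mono {D} {E} E∌far x∈ =
      near⁺ D (near⊆U E x∈) λ x∈far → near∌far E x∈ (far-mono E∌far x∈far)

    -- A walk in `U` from `q` to `D` stays in `far q D` until it first meets `D`, so it misses `E`;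
    -- the rest of `D` is then reached inside `D`. The base point `q` may itself lie in `D`.
    far-absorbs : Conn U → q ∈ U → ∀ {D E} → Region D → E ⊆ near q D → (∀ {x} → x ∈ E → x ∉ D) →
                  D ⊆ far q E
    far-absorbs U-conn q∈U {D} {E} (D⊆U , (d , d∈D) , D-conn) E⊆ E∌D =
      conn⊆comp D-conn D⊆U─E d∈D (chase (U-conn q∈U (D⊆U d∈D)) (proj₁ q-start) (proj₂ q-start))
      where
      D⊆U─E : D ⊆ U ─ E
      D⊆U─E x∈ = x∈p∧x∉q⇒x∈p─q (D⊆U x∈) λ x∈E → E∌D x∈E x∈
      q-start : q ∈ far q E × (q ∈ far q D ⊎ q ∈ D)
      q-start with q ∈? D
      ... | yes q∈D = comp⁺ (stop (D⊆U─E q∈D)) , inj₂ q∈D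
      ... | no q∉D = let q∈far = comp⁺ (stop (x∈p∧x∉q⇒x∈p─q q∈U q∉D)) in
        comp⁺ (stop (x∈p∧x∉q⇒x∈p─q q∈U λ q∈E → near∌far D (E⊆ q∈E) q∈far)) , inj₁ q∈far
      chase : ∀ {u} → Walk (_∈ U) u d → u ∈ far q E → u ∈ far q D ⊎ u ∈ D → d ∈ far q E
      chase _ u∈E (inj₂ u∈D) = conn⊆comp D-conn D⊆U─E u∈D u∈E d∈D
      chase (stop _) u∈E _ = u∈E
      chase (step {w = w} _ a ω) u∈E (inj₁ u∈far) with w ∈? D
      ... | yes w∈D = chase ω (far-closed E u∈E (walk-source ω) (λ w∈E → E∌D w∈E w∈D) a) (inj₂ w∈D)
      ... | no w∉D = let w∈far = far-closed D u∈far (walk-source ω) w∉D a in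
        chase ω (far-mono (λ x∈E → near∌far D (E⊆ x∈E)) w∈far) (inj₁ w∈far)

    -- A walk from a vertex of `near q D` to `D` cannot enter the far side before it meets `D`; from
    -- there on one stays in the connected set `D`.
    near-conn : Conn U → ∀ {D} → Region D → Conn (near q D)
    near-conn U-conn {D} (D⊆U , (d , d∈D) , D-conn) u∈ v∈ = toD u∈ ◅◅ reverse (toD v∈)
      where
      go : ∀ {u} → Walk (_∈ U) u d → u ∈ near q D → Walk (_∈ near q D) u d
      go (stop _) u∈ = stop u∈
      go (step {u} {w} _ a ω) u∈ with u ∈? D | w ∈? far q D
      ... | yes u∈D | _ = walk-map (D⊆near D⊆U) (D-conn u∈D d∈D)
      ... | no u∉D | yes w∈ = contradiction (far-closed D w∈ (near⊆U D u∈) u∉D (Adj-sym a)) (near∌far D u∈)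
      ... | no _ | no w∉ = step u∈ a (go ω (near⁺ D (walk-source ω) w∉))
      toD : ∀ {u} → u ∈ near q D → Walk (_∈ near q D) u d
      toD u∈ = go (U-conn (near⊆U D u∈) (D⊆U d∈D)) u∈

    -- If the chosen vertex of `E` is in `D`, then `E` lies inside `D` and misses the bag vertex
    -- `d`, so the region itself shrinks. If not, all of `D` ends up on the far side of `E`, so the
    -- near set loses `d`.
    near-shrinks : Conn U → q ∈ U → ∀ {B D E} → Region D → Region E →
                   (∀ {w} → Boundary D w → w ∈ B) → (∃ λ d → d ∈ D × d ∈ B) →
                   E ⊆ near q D → (∀ {x} → x ∈ E → x ∉ B) →
                   E ≺[ q ] D
    near-shrinks U-conn q∈U {B} {D} {E} rD@(D⊆U , _) rE@(_ , (e , e∈E) , _) guards (d , d∈D , d∈B) E⊆ E∌B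
      with e ∈? D
    ... | yes e∈D = inj₂ (p⊆q⇒∣p∣≤∣q∣ near⊆ , p⊂q⇒∣p∣<∣q∣ (guarded⊆ rE guards E∌B e∈E e∈D , d , d∈D , λ d∈E → E∌B d∈E d∈B))
      where
      near⊆ : near q E ⊆ near q D
      near⊆ = near-mono λ x∈E → near∌far D (E⊆ x∈E)
    ... | no e∉D = inj₁ (p⊂q⇒∣p∣<∣q∣ (near-mono (λ x∈E → near∌far D (E⊆ x∈E)) , d , D⊆near D⊆U d∈D ,
            λ d∈near → near∌far E d∈near (far-absorbs U-conn q∈U rD E⊆ E∌D d∈D)))
      where
      E∌D : ∀ {x} → x ∈ E → x ∉ D
      E∌D x∈E x∈D = e∉D (guarded⊆ rE guards E∌B x∈E x∈D e∈E)

  -- A path decomposition of the subgraph induced on `C` with bags of at most `ℓ` vertices: no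
  -- outside vertices are permitted, so there is nothing to glue.
  Light : ℕ → Subset (n G) → Set
  Light ℓ C = Sweep C ℓ C (λ _ → ⊥)

  -- Gluing light pieces to a sweep

  module Assembly {t ℓ : ℕ} {Z B Re : Subset (n G)} (∣B∣≤t : ∣ B ∣ ≤ t) (Z⊆U : Z ⊆ U) (Re⊆Z : Re ⊆ Z)
    (Z-closed : ∀ {u w} → u ∈ Z → w ∈ U → Adj G u w → w ∈ Z ⊎ w ∈ B)
    (Re-closed : ∀ {u w} → u ∈ Re → u ∉ B → w ∈ U → w ∉ B → Adj G u w → w ∈ Re)
    (lights : ∀ {v} → v ∈ Z → v ∉ B → v ∉ Re → Light ℓ (piece B v))
    where

    private
      -- Bag vertices inside `Re` are already served by the sweep of `Re`; only the remaining ones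
      -- are carried along in the new bags.
      M : Subset (n G)
      M = B ─ Re

      M⁺ : ∀ {v} → v ∈ B → v ∉ Re → v ∈ M
      M⁺ = x∈p∧x∉q⇒x∈p─q

      M⊆B : M ⊆ B
      M⊆B = p─q⊆p B Re

      M∌Re : ∀ {v} → v ∈ M → v ∉ Re
      M∌Re = ∈─⇒∉ B Re

      ∣M∣≤t : ∣ M ∣ ≤ t
      ∣M∣≤t = ℕ.≤-trans (∣p─q∣≤∣p∣ B Re) ∣B∣≤t

    -- Every piece outside Re is inserted with M added to all its bags, in front of what is already there.
    record Partial : Set where
      field
        bags       : List (Subset (n G))
        small      : All (λ A → ∣ A ∣ ≤ t + ℓ) bags
        contiguous : Contiguous bags
        front      : ∀ {v} → v ∈ M → InFirst bags v
        within     : ∀ {v} → Covers bags v → v ∈ Z ⊎ v ∈ B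
        core       : ∀ {v} → v ∈ Re → Covers bags v
        closed     : ∀ {u w} → Covers bags u → u ∉ B → w ∈ U → w ∉ B → Adj G u w → Covers bags w
        edge       : ∀ {u w} → Covers bags u → u ∉ B ⊎ u ∈ Re → w ∈ U → Adj G u w → Joins bags u w

    -- `M` is placed in front as a bag of its own. It is disjoint from `Re`, so whatever it shares
    -- with the sweep lies in the first bag there.
    start : Sweep U (t + ℓ) Re (_∈ B) → Partial
    start S = record
      { bags = M ∷ bags
      ; small = ℕ.≤-trans ∣M∣≤t (ℕ.m≤m+n t ℓ) ∷ small
      ; contiguous = (λ v∈M c → front c (M∌Re v∈M)) , contiguous
      ; front = id
      ; within = λ where
          (here v∈M) → inj₂ (M⊆B v∈M)
          (there c) → Sum.map Re⊆Z id (within c)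
      ; core = there ∘ cover
      ; closed = λ where
          (here u∈M) u∉B → contradiction (M⊆B u∈M) u∉B
          (there c) u∉B w∈U w∉B a → case within c of λ where
            (inj₁ u∈Re) → there (cover (Re-closed u∈Re u∉B w∈U w∉B a))
            (inj₂ u∈B) → contradiction u∈B u∉B
      ; edge = λ where
          (here u∈M) (inj₁ u∉B) → contradiction (M⊆B u∈M) u∉B
          (here u∈M) (inj₂ u∈Re) → contradiction u∈Re (M∌Re u∈M)
          (there c) (inj₂ u∈Re) w∈U a → there (edge u∈Re w∈U a)
          (there c) (inj₁ u∉B) w∈U a → case within c of λ where
            (inj₁ u∈Re) → there (edge u∈Re w∈U a)
            (inj₂ u∈B) → contradiction u∈B u∉B }
      where open Sweep S

    module Insert (P : Partial) {v} (v∈Z : v ∈ Z) (v∉B : v ∉ B) (v∉P : ¬ Covers (Partial.bags P) v) where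
      open Partial P

      C : Subset (n G)
      C = piece B v

      L : Light ℓ C
      L = lights v∈Z v∉B (v∉P ∘ core)

      open Sweep L using () renaming
        (bags to Ls; small to L-small; contiguous to L-contiguous; cover to L-cover; within to L-within; edge to L-edge)

      L⊆C : ∀ {x} → Covers Ls x → x ∈ C
      L⊆C c = [ id , ⊥-elim ]′ (L-within c)

      C⊆Z : C ⊆ Z
      C⊆Z = piece⊆ (λ u∈ _ w∈U w∉B a → [ id , (λ w∈B → contradiction w∈B w∉B) ]′ (Z-closed u∈ w∈U a)) v∈Z

      -- The vertices covered so far are closed under steps that avoid `B`, so a piece is covered
      -- entirely or not at all.
      C∌P : ∀ {x} → x ∈ C → ¬ Covers bags x
      C∌P x∈C c = v∉P (go (reverse (comp⁻ x∈C)) c)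
        where
        go : ∀ {u x} → Walk (_∈ U ─ B) u x → Covers bags u → Covers bags x
        go (stop _) c = c
        go (step p a ω) c = go ω (closed c (∈─⇒∉ U B p) (p─q⊆p U B (walk-source ω)) (∈─⇒∉ U B (walk-source ω)) a)

      C-cover : ∀ {x} → x ∈ C → Covers (widen M Ls ++ bags) x
      C-cover x∈ = Any.++⁺ˡ (covers-widen⁺ M (L-cover x∈))

      front′ : ∀ {x} Ls → x ∈ M → InFirst (widen M Ls ++ bags) x
      front′ [] x∈ = front x∈
      front′ (A ∷ _) x∈ = p⊆p∪q A x∈

      C-edge : ∀ {u w} → u ∈ C → w ∈ U → Adj G u w → Joins (widen M Ls ++ bags) u w
      C-edge {u} {w} u∈ w∈U a with w ∈? C
      ... | yes w∈C = Any.++⁺ˡ (Any.map⁺ (Any.map (λ {A} (x , y) → q⊆p∪q M A x , q⊆p∪q M A y) (L-edge u∈ w∈C a)))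
      ... | no w∉C with piece-guards (w∈U , w∉C , u , u∈ , a) | w ∈? Re
      -- An end in `Re` already has all its edges in the old bags.
      ...   | w∈B | yes w∈Re = Any.++⁺ʳ (widen M Ls) (joins-sym (edge (core w∈Re) (inj₂ w∈Re) (piece⊆U u∈) (Adj-sym a)))
      -- An end in `M` belongs to every bag of the widened piece.
      ...   | w∈B | no w∉Re = Any.++⁺ˡ (Any.map⁺ (Any.map (λ {A} x → q⊆p∪q M A x , p⊆p∪q A (M⁺ w∈B w∉Re)) (L-cover u∈)))

      inserted : Partial
      inserted = record
        { bags = widen M Ls ++ bags
        ; small = All.++⁺ (All.map⁺ (All.map (λ {A} le →
            ℕ.≤-trans (∣p∪q∣≤∣p∣+∣q∣ M A) (ℕ.+-mono-≤ ∣M∣≤t le)) L-small)) small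
        ; contiguous = contiguous-++ (widen M Ls) (contiguous-widen M Ls L-contiguous) contiguous
            λ c c′ → case covers-widen⁻ M Ls c of λ where
              (inj₁ x∈M) → all-widen M Ls x∈M , front x∈M
              (inj₂ x∈L) → contradiction c′ (C∌P (L⊆C x∈L))
        ; front = front′ Ls
        ; within = λ c → case split c of λ where
            (inj₁ (inj₁ x∈M)) → inj₂ (M⊆B x∈M)
            (inj₁ (inj₂ x∈C)) → inj₁ (C⊆Z x∈C)
            (inj₂ c′) → within c′
        ; core = λ x∈ → Any.++⁺ʳ (widen M Ls) (core x∈)
        ; closed = λ c u∉B w∈U w∉B a → case split c of λ where
            (inj₁ (inj₁ u∈M)) → contradiction (M⊆B u∈M) u∉B
            (inj₁ (inj₂ u∈C)) → C-cover (comp-closed u∈C (x∈p∧x∉q⇒x∈p─q w∈U w∉B) a)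
            (inj₂ c′) → Any.++⁺ʳ (widen M Ls) (closed c′ u∉B w∈U w∉B a)
        ; edge = λ c side w∈U a → case split c of λ where
            (inj₁ (inj₁ u∈M)) → [ contradiction (M⊆B u∈M) , (λ u∈Re → contradiction u∈Re (M∌Re u∈M)) ]′ side
            (inj₁ (inj₂ u∈C)) → C-edge u∈C w∈U a
            (inj₂ c′) → Any.++⁺ʳ (widen M Ls) (edge c′ side w∈U a) }
        where
        split : ∀ {x} → Covers (widen M Ls ++ bags) x → (x ∈ M ⊎ x ∈ C) ⊎ Covers bags x
        split c = Sum.map (Sum.map id L⊆C ∘ covers-widen⁻ M Ls) id (Any.++⁻ (widen M Ls) c)

    insert : (P : Partial) → ∀ v → Σ Partial λ P′ →
             (v ∈ Z → v ∉ B → Covers (Partial.bags P′) v) ×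
             (∀ {u} → Covers (Partial.bags P) u → Covers (Partial.bags P′) u)
    insert P v with v ∈? Z | v ∈? B | Any.any? (v ∈?_) (Partial.bags P)
    ... | no v∉Z | _ | _ = P , (λ v∈Z → contradiction v∈Z v∉Z) , id
    ... | yes _ | yes v∈B | _ = P , (λ _ v∉B → contradiction v∈B v∉B) , id
    ... | yes _ | no _ | yes c = P , (λ _ _ → c) , id
    ... | yes v∈Z | no v∉B | no v∉P =
      inserted , (λ _ _ → C-cover (v∈piece (Z⊆U v∈Z) v∉B)) , Any.++⁺ʳ (widen M (Sweep.bags L))
      where open Insert P v∈Z v∉B v∉P

    insertAll : Partial → ∀ vs → Σ Partial λ P → All (λ v → v ∈ Z → v ∉ B → Covers (Partial.bags P) v) vs
    insertAll P [] = P , []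
    insertAll P (v ∷ vs) =
      let P₁ , done = insertAll P vs
          P₂ , new , keep = insert P₁ v
      in P₂ , new ∷ All.map (λ f v∈Z v∉B → keep (f v∈Z v∉B)) done

    assemble : Sweep U (t + ℓ) Re (_∈ B) → Sweep U (t + ℓ) Z (_∈ B)
    assemble S = record
      { bags = bags ; small = small ; contiguous = contiguous ; cover = cover ; within = within
      ; front = λ c v∉Z → front (M⁺ ([ (λ v∈Z → contradiction v∈Z v∉Z) , id ]′ (within c)) (v∉Z ∘ Re⊆Z))
      ; edge = edge′ }
      where
      final : Σ Partial λ P → All (λ v → v ∈ Z → v ∉ B → Covers (Partial.bags P) v) (allFin (n G))
      final = insertAll (start S) (allFin (n G))
      open Partial (proj₁ final)
      cover : ∀ {v} → v ∈ Z → Covers bags v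
      cover {v} v∈Z with v ∈? B | v ∈? Re
      ... | no v∉B | _ = All.lookup (proj₂ final) (∈-allFin v) v∈Z v∉B
      ... | yes _ | yes v∈Re = core v∈Re
      ... | yes v∈B | no v∉Re = first⇒covers bags (front (M⁺ v∈B v∉Re))
      edge′ : ∀ {u w} → u ∈ Z → w ∈ U → Adj G u w → Joins bags u w
      edge′ {u} {w} u∈Z w∈U a with u ∈? B | u ∈? Re | w ∈? B | w ∈? Re
      ... | no u∉B | _ | _ | _ = edge (cover u∈Z) (inj₁ u∉B) w∈U a
      ... | yes _ | yes u∈Re | _ | _ = edge (core u∈Re) (inj₂ u∈Re) w∈U a
      ... | yes _ | no _ | _ | yes w∈Re = joins-sym (edge (core w∈Re) (inj₂ w∈Re) (Z⊆U u∈Z) (Adj-sym a))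
      -- Both ends are in `M`, which the first bag contains.
      ... | yes u∈B | no u∉Re | yes w∈B | no w∉Re = first⇒joins bags (front (M⁺ u∈B u∉Re)) (front (M⁺ w∈B w∉Re))
      ... | yes _ | no _ | no w∉B | no _ with Z-closed u∈Z w∈U a
      ...   | inj₁ w∈Z = joins-sym (edge (cover w∈Z) (inj₁ w∉B) (Z⊆U u∈Z) (Adj-sym a))
      ...   | inj₂ w∈B = contradiction w∈B w∉B

-- The path of separators

module Backbone (G : Graph) (h t ℓ : ℕ) (U : Subset (n G)) (U-nonempty : Nonempty U) (U-conn : Walks.Conn G U)
  -- `Small` will mean a subset of a tree bag in the inductive step, and a clique on at most two
  -- vertices at `h = 0`.
  (Small : Subset (n G) → Set) (small⇒≤ : ∀ {B} → Small B → ∣ B ∣ ≤ t) (small-∅ : ∃ Small)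
  (separate : ∀ D → Regions.Region G U D → Regions.Anchored G U Small D →
              InT (suc h) G U ⊎ Regions.Separator G U Small D)
  (classify : ∀ C → Regions.Region G U C → InT h G C ⊎ Regions.Light G U ℓ C)
  where
  open Walks G
  open Sweeps G
  open Regions G U

  Goal : Set
  Goal = InT (suc h) G U

  piece-anchored : ∀ {B v} → Small B → Anchored Small (piece B v)
  piece-anchored {B} sB = B , sB , piece-guards

  disjoint : ∀ {A B : Subset (n G)} → (∀ {x} → x ∈ A → x ∉ B) → ¬ Nonempty (A ∩ B)
  disjoint {A} {B} f (x , x∈) = let x∈A , x∈B = x∈p∩q⁻ A B x∈ in f x∈A x∈B

  three-regions : ∀ {A B C} → Region A → Region B → Region C → InT h G A → InT h G B → InT h G C →
                  (∀ {x} → x ∈ A → x ∉ B) → (∀ {x} → x ∈ A → x ∉ C) → (∀ {x} → x ∈ B → x ∉ C) →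
                  ∀ {a b c} → a ∈ A → b ∈ B → c ∈ C →
                  Walk (λ x → x ∈ U × x ∉ C) a b → Walk (λ x → x ∈ U × x ∉ B) a c →
                  Walk (λ x → x ∈ U × x ∉ A) b c → Goal
  three-regions {A} {B} {C} (A⊆ , _) (B⊆ , _) (C⊆ , _) tA tB tC AB AC BC a∈ b∈ c∈ ab ac bc =
    connectedIn U-nonempty U-conn , A , B , C , (A⊆ , B⊆ , C⊆) , (disjoint AB , disjoint AC , disjoint BC) ,
    (tA , tB , tC) ,
    (_ , _ , a∈ , b∈ , walk→path ab) , (_ , _ , a∈ , c∈ , walk→path ac) , (_ , _ , b∈ , c∈ , walk→path bc)

  module Based (H : Subset (n G)) (H-region : Region H) (H-heavy : InT h G H) (q : Vertex) (q∈H : q ∈ H) where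

    q∈U : q ∈ U
    q∈U = proj₁ H-region q∈H

    H⊆far : ∀ {D} → (∀ {x} → x ∈ D → x ∉ H) → H ⊆ far q D
    H⊆far D∌H x∈ = comp⁺ (walk-map (λ y∈ → x∈p∧x∉q⇒x∈p─q (proj₁ H-region y∈) λ y∈D → D∌H y∈D y∈)
                              (proj₂ (proj₂ H-region) q∈H x∈))

    far-walk : ∀ {D x} → x ∈ far q D → Walk (λ y → y ∈ U × y ∉ D) x q
    far-walk {D} x∈ = reverse (walk-map (λ y∈ → p─q⊆p U D y∈ , ∈─⇒∉ U D y∈) (comp⁻ x∈))

    -- `W` lies on one side of `H`: `W-linked` joins any two of its pieces without touching `H`,
    -- which is the link between the two pieces in a structure with `H` as third set.
    module Leader (B W : Subset (n G)) (W⊆U : W ⊆ U) (W∌H : ∀ {x} → x ∈ W → x ∉ H)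
      (W-pieces : ∀ {v} → v ∈ W → v ∉ B → piece B v ⊆ W)
      (W-linked : ∀ {u v} → u ∈ W → v ∈ W → Walk (λ x → x ∈ U × x ∉ H) u v) where

      Settled : Vertex → Vertex → Set
      Settled e v = v ∈ W → v ∉ B → v ∈ near q (piece B e) ⊎ Light ℓ (piece B v)

      Leads : Vertex → List Vertex → Set
      Leads e vs = e ∈ W × e ∉ B × InT h G (piece B e) × All (Settled e) vs

      Outcome : List Vertex → Set
      Outcome vs = Goal ⊎ (All (λ v → v ∈ W → v ∉ B → Light ℓ (piece B v)) vs ⊎ ∃ λ e → Leads e vs)

      skip : ∀ {v vs} → (v ∈ W → v ∉ B → Light ℓ (piece B v)) → Outcome vs → Outcome (v ∷ vs)
      skip l (inj₁ g) = inj₁ g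
      skip l (inj₂ (inj₁ ls)) = inj₂ (inj₁ (l ∷ ls))
      skip l (inj₂ (inj₂ (e , e∈W , e∉B , he , ss))) =
        inj₂ (inj₂ (e , e∈W , e∉B , he , (λ v∈W v∉B → inj₂ (l v∈W v∉B)) ∷ ss))

      self-near : ∀ {v} → v ∈ W → v ∉ B → v ∈ near q (piece B v)
      self-near v∈W v∉B = D⊆near q piece⊆U (v∈piece (W⊆U v∈W) v∉B)

      -- Two heavy pieces neither of which separates the other from q form, with H, a T_{h+1} structure.
      challenge : ∀ {v vs} → v ∈ W → v ∉ B → InT h G (piece B v) → Outcome vs → Outcome (v ∷ vs)
      challenge _ _ _ (inj₁ g) = inj₁ g
      challenge v∈W v∉B hv (inj₂ (inj₁ ls)) =
        inj₂ (inj₂ (_ , v∈W , v∉B , hv , (λ _ _ → inj₁ (self-near v∈W v∉B)) ∷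
          All.map (λ l u∈W u∉B → inj₂ (l u∈W u∉B)) ls))
      challenge {v} v∈W v∉B hv (inj₂ (inj₂ (e , e∈W , e∉B , he , ss)))
        with v ∈? near q (piece B e) | e ∈? near q (piece B v)
      ... | yes v∈ | _ = inj₂ (inj₂ (e , e∈W , e∉B , he , (λ _ _ → inj₁ v∈) ∷ ss))
      -- The challenger separates the old leader from `q`, so its near set contains that of the old
      -- leader and inherits all that was settled.
      ... | no v∉ | yes e∈ = inj₂ (inj₂ (v , v∈W , v∉B , hv , (λ _ _ → inj₁ (self-near v∈W v∉B)) ∷
              All.map (λ s u∈W u∉B → Sum.map (near-mono q E∌far) id (s u∈W u∉B)) ss))
        where
        E∌C : ∀ {x} → x ∈ piece B e → x ∉ piece B v
        E∌C x∈E x∈C = v∉ (D⊆near q piece⊆U (comp⁺ (comp⁻ x∈E ◅◅ reverse (comp⁻ x∈C))))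
        E∌far : ∀ {x} → x ∈ piece B e → x ∉ far q (piece B v)
        E∌far x∈E x∈far = near∌far q (piece B v) e∈
          (conn⊆comp comp-conn (λ y∈ → x∈p∧x∉q⇒x∈p─q (piece⊆U y∈) (E∌C y∈)) x∈E x∈far
            (v∈piece (W⊆U e∈W) e∉B))
      ... | no v∉ | no e∉ = inj₁ (three-regions
              (piece-region (W⊆U e∈W) e∉B) (piece-region (W⊆U v∈W) v∉B) H-region he hv H-heavy
              (λ x∈E x∈C → v∉ (D⊆near q piece⊆U (comp⁺ (comp⁻ x∈E ◅◅ reverse (comp⁻ x∈C)))))
              (λ x∈ → W∌H (W-pieces e∈W e∉B x∈)) (λ x∈ → W∌H (W-pieces v∈W v∉B x∈))
              (v∈piece (W⊆U e∈W) e∉B) (v∈piece (W⊆U v∈W) v∉B) q∈H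
              (W-linked e∈W v∈W) (far-walk (in-far e∈W e∉)) (far-walk (in-far v∈W v∉)))
        where
        in-far : ∀ {x D} → x ∈ W → x ∉ near q D → x ∈ far q D
        in-far {x} {D} x∈W x∉ with x ∈? far q D
        ... | yes x∈ = x∈
        ... | no x∉far = contradiction (near⁺ q D (W⊆U x∈W) x∉far) x∉

      elect : ∀ vs → Outcome vs
      elect [] = inj₂ (inj₁ [])
      elect (v ∷ vs) with v ∈? W | v ∈? B
      ... | no v∉W | _ = skip (λ v∈W → contradiction v∈W v∉W) (elect vs)
      ... | yes _ | yes v∈B = skip (λ _ v∉B → contradiction v∈B v∉B) (elect vs)
      ... | yes v∈W | no v∉B with classify (piece B v) (piece-region (W⊆U v∈W) v∉B)
      ...   | inj₁ hv = challenge v∈W v∉B hv (elect vs)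
      ...   | inj₂ l = skip (λ _ _ → l) (elect vs)

      leader : Goal ⊎ ((∀ {v} → v ∈ W → v ∉ B → Light ℓ (piece B v)) ⊎
                       ∃ λ e → e ∈ W × e ∉ B × InT h G (piece B e) × (∀ {v} → Settled e v))
      leader with elect (allFin (n G))
      ... | inj₁ g = inj₁ g
      ... | inj₂ (inj₁ ls) = inj₂ (inj₁ (All.lookup ls (∈-allFin _)))
      ... | inj₂ (inj₂ (e , e∈W , e∉B , he , ss)) =
        inj₂ (inj₂ (e , e∈W , e∉B , he , λ {v} → All.lookup ss (∈-allFin v)))

    Swept : Subset (n G) → Set
    Swept D = Region D → Anchored Small D → (∀ {x} → x ∈ D → x ∉ H) →
              Goal ⊎ Sweep U (t + ℓ) (near q D) (Boundary D)

    -- If no piece near `D` is heavy, the light ones are glued to the bag alone. Otherwise the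
    -- leader is swept recursively, and by its choice every piece in `near q D` outside its near set
    -- is light.
    sweep-near-step : ∀ D → (∀ E → E ≺[ q ] D → Swept E) → Swept D
    sweep-near-step D ih rD@(D⊆U , _) anch D∌H with separate D rD anch
    ... | inj₁ g = inj₁ g
    ... | inj₂ S = handle leader
      where
      open Separator S renaming (bag to B)
      W : Subset (n G)
      W = near q D
      W-closed : ∀ {u w} → u ∈ W → w ∈ U → Adj G u w → w ∈ W ⊎ w ∈ B
      W-closed u∈ w∈U a = Sum.map id guards (near-closed q D u∈ w∈U a)
      W∌H : ∀ {x} → x ∈ W → x ∉ H
      W∌H x∈ x∈H = near∌far q D x∈ (H⊆far D∌H x∈H)
      W-pieces : ∀ {v} → v ∈ W → v ∉ B → piece B v ⊆ W
      W-pieces v∈ _ = piece⊆ (λ u∈ _ w∈U w∉B a → [ id , (λ w∈B → contradiction w∈B w∉B) ]′ (W-closed u∈ w∈U a)) v∈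
      open Leader B W (near⊆U q D) W∌H W-pieces
        (λ u∈ v∈ → walk-map (λ x∈ → near⊆U q D x∈ , W∌H x∈) (near-conn q U-conn rD u∈ v∈))
      -- A bag vertex outside `near q D` is not in `D`, so `nearby` puts it on the boundary, where
      -- it may be shared with the rest.
      to-boundary : Sweep U (t + ℓ) W (_∈ B) → Sweep U (t + ℓ) W (Boundary D)
      to-boundary = sweep-mono ℕ.≤-refl λ v∉W v∈B →
        [ (λ v∈D → contradiction (D⊆near q D⊆U v∈D) v∉W) , id ]′ (nearby v∈B)
      handle : Goal ⊎ ((∀ {v} → v ∈ W → v ∉ B → Light ℓ (piece B v)) ⊎
                       ∃ λ e → e ∈ W × e ∉ B × InT h G (piece B e) × (∀ {v} → Settled e v)) →
               Goal ⊎ Sweep U (t + ℓ) W (Boundary D)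
      handle (inj₁ g) = inj₁ g
      handle (inj₂ (inj₁ ls)) = inj₂ (to-boundary (assemble empty-sweep))
        where open Assembly {t} {ℓ} {W} {B} {∅} (small⇒≤ small) (near⊆U q D) (⊥⊆) W-closed
                (λ u∈ → contradiction u∈ ∉⊥) (λ v∈ v∉B _ → ls v∈ v∉B)
      handle (inj₂ (inj₂ (e , e∈W , e∉B , he , settled))) = Sum.map id (to-boundary ∘ extend) recursive
        where
        E : Subset (n G)
        E = piece B e
        rE : Region E
        rE = piece-region (near⊆U q D e∈W) e∉B
        E⊆W : E ⊆ W
        E⊆W = W-pieces e∈W e∉B
        recursive : Goal ⊎ Sweep U (t + ℓ) (near q E) (Boundary E)
        recursive = ih E (near-shrinks q U-conn q∈U rD rE guards advance E⊆W piece∌B)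
                      rE (piece-anchored small) (λ x∈ → W∌H (E⊆W x∈))
        extend : Sweep U (t + ℓ) (near q E) (Boundary E) → Sweep U (t + ℓ) W (_∈ B)
        extend S′ = assemble (sweep-mono ℕ.≤-refl (λ _ → piece-guards) S′)
          where open Assembly {t} {ℓ} {W} {B} {near q E} (small⇒≤ small) (near⊆U q D)
                  (near-mono q (λ x∈E → near∌far q D (E⊆W x∈E))) W-closed
                  (λ u∈ u∉B w∈U w∉B a → [ id , (λ b → contradiction (piece-guards b) w∉B) ]′ (near-closed q E u∈ w∈U a))
                  (λ v∈ v∉B v∉near → [ (λ v∈near → contradiction v∈near v∉near) , id ]′ (settled v∈ v∉B))

    sweep-near : ∀ D → Swept D
    sweep-near = lex-induction (∣_∣ ∘ near q) ∣_∣ Swept sweep-near-step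

  -- With only light pieces on its near side, `D` serves as an end of the path: it takes the role of
  -- `H`, and the leader is sought on the other side, `far q₀ D`.
  sweep-around : ∀ {D q} → q ∈ U → Region D → InT h G D → (S : Separator Small D) →
                 (∀ {v} → v ∈ near q D → v ∉ Separator.bag S → Light ℓ (piece (Separator.bag S) v)) →
                 Goal ⊎ Light (t + ℓ) U
  sweep-around {D} {q₀} q₀∈U rD@(D⊆U , _) hD S lights = handle leader
    where
    open Separator S renaming (bag to B)
    q : Vertex
    q = proj₁ advance
    open Based D rD hD q (proj₁ (proj₂ advance))
    W : Subset (n G)
    W = far q₀ D
    W-pieces : ∀ {v} → v ∈ W → v ∉ B → piece B v ⊆ W
    W-pieces v∈ _ = piece⊆ stays v∈
      where
      stays : ∀ {u w} → u ∈ W → u ∉ B → w ∈ U → w ∉ B → Adj G u w → w ∈ W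
      stays {u} {w} u∈ u∉B w∈U w∉B a with w ∈? D
      ... | no w∉D = far-closed q₀ D u∈ w∈U w∉D a
      -- An edge from the far side into `D` starts at a boundary vertex of `D`, hence in `B`.
      ... | yes w∈D = contradiction (guards (far⊆U q₀ D u∈ , far∌D q₀ D u∈ , w , w∈D , Adj-sym a)) u∉B
    open Leader B W (far⊆U q₀ D) (far∌D q₀ D) W-pieces
      (λ u∈ v∈ → walk-map (λ x∈ → far⊆U q₀ D x∈ , far∌D q₀ D x∈) (comp-conn u∈ v∈))
    confine : Sweep U (t + ℓ) U (_∈ B) → Light (t + ℓ) U
    confine = sweep-mono ℕ.≤-refl λ v∉U v∈B → v∉U ([ D⊆U , proj₁ ]′ (nearby v∈B))
    handle : Goal ⊎ ((∀ {v} → v ∈ W → v ∉ B → Light ℓ (piece B v)) ⊎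
                     ∃ λ e → e ∈ W × e ∉ B × InT h G (piece B e) × (∀ {v} → Settled e v)) →
             Goal ⊎ Light (t + ℓ) U
    handle (inj₁ g) = inj₁ g
    handle (inj₂ (inj₁ ls)) = inj₂ (confine (assemble empty-sweep))
      where
      everywhere : ∀ {v} → v ∈ U → v ∉ B → Light ℓ (piece B v)
      everywhere {v} v∈U v∉B with v ∈? W
      ... | yes v∈W = ls v∈W v∉B
      ... | no v∉W = lights (near⁺ q₀ D v∈U v∉W) v∉B
      open Assembly {t} {ℓ} {U} {B} {∅} (small⇒≤ small) id ⊥⊆ (λ _ w∈U _ → inj₁ w∈U)
        (λ u∈ → contradiction u∈ ∉⊥) (λ v∈ v∉B _ → everywhere v∈ v∉B)
    handle (inj₂ (inj₂ (e , e∈W , e∉B , he , settled))) =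
      Sum.map id (λ S′ → confine (assemble (sweep-mono ℕ.≤-refl (λ _ → piece-guards) S′)))
        (sweep-near E (piece-region (far⊆U q₀ D e∈W) e∉B) (piece-anchored small)
          (λ x∈ → far∌D q₀ D (W-pieces e∈W e∉B x∈)))
      where
      E : Subset (n G)
      E = piece B e
      everywhere : ∀ {v} → v ∈ U → v ∉ B → v ∉ near q E → Light ℓ (piece B v)
      everywhere {v} v∈U v∉B v∉near with v ∈? W
      ... | yes v∈W = [ (λ v∈near → contradiction v∈near v∉near) , id ]′ (settled v∈W v∉B)
      ... | no v∉W = lights (near⁺ q₀ D v∈U v∉W) v∉B
      open Assembly {t} {ℓ} {U} {B} {near q E} (small⇒≤ small) id (near⊆U q E) (λ _ w∈U _ → inj₁ w∈U)
        (λ u∈ u∉B w∈U w∉B a → [ id , (λ b → contradiction (piece-guards b) w∉B) ]′ (near-closed q E u∈ w∈U a))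
        everywhere

  Descended : Subset (n G) → Set
  Descended D = Region D → Anchored Small D → InT h G D → Goal ⊎ Light (t + ℓ) U

  -- Replacing D by a heavy piece near it ends at a region that is one end of the path.
  descend-step : ∀ {q} → q ∈ U → ∀ D → (∀ E → E ≺[ q ] D → Descended E) → Descended D
  descend-step {q} q∈U D ih rD anch hD with separate D rD anch
  ... | inj₁ g = inj₁ g
  ... | inj₂ S = handle (find⊎all search)
    where
    open Separator S renaming (bag to B)
    W : Subset (n G)
    W = near q D
    Heavy : Vertex → Set
    Heavy v = v ∈ W × v ∉ B × InT h G (piece B v)
    search : ∀ v → Heavy v ⊎ (v ∈ W → v ∉ B → Light ℓ (piece B v))
    search v with v ∈? W | v ∈? B
    ... | no v∉W | _ = inj₂ λ v∈W → contradiction v∈W v∉W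
    ... | yes _ | yes v∈B = inj₂ λ _ v∉B → contradiction v∈B v∉B
    ... | yes v∈W | no v∉B = Sum.map (λ hv → v∈W , v∉B , hv) (λ l _ _ → l)
                               (classify (piece B v) (piece-region (near⊆U q D v∈W) v∉B))
    handle : ∃ Heavy ⊎ (∀ v → v ∈ W → v ∉ B → Light ℓ (piece B v)) → Goal ⊎ Light (t + ℓ) U
    handle (inj₂ ls) = sweep-around q∈U rD hD S (λ {v} → ls v)
    handle (inj₁ (e , e∈W , e∉B , he)) =
      ih E (near-shrinks q U-conn q∈U rD rE guards advance E⊆W piece∌B) rE (piece-anchored small) he
      where
      E : Subset (n G)
      E = piece B e
      rE : Region E
      rE = piece-region (near⊆U q D e∈W) e∉B
      E⊆W : E ⊆ W
      E⊆W = piece⊆ (λ u∈ _ w∈U w∉B a →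
        [ id , (λ b → contradiction (guards b) w∉B) ]′ (near-closed q D u∈ w∈U a)) e∈W

  descend : ∀ {q} → q ∈ U → ∀ D → Descended D
  descend {q} q∈U = lex-induction (∣_∣ ∘ near q) ∣_∣ Descended (descend-step q∈U)

  sweep : Goal ⊎ Light (t + ℓ) U
  sweep with classify U (id , U-nonempty , U-conn)
  -- The descent starts at `U`, whose boundary is empty, so any small set anchors it.
  ... | inj₁ hU = descend (proj₂ U-nonempty) U (id , U-nonempty , U-conn)
          (proj₁ small-∅ , proj₂ small-∅ , λ (w∈ , w∉ , _) → contradiction w∈ w∉) hU
  ... | inj₂ l = inj₂ (sweep-mono (ℕ.m≤n+m ℓ t) (λ _ → id) l)

-- Where the separators come from

module TreeSeparators (G : Graph) (D : TreeDecomposition G) (U : Subset (n G)) where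
  open TreeDecomposition D
  open Walks G
  open Regions G U
  module T = Walks T

  InBag : Subset (n G) → Set
  InBag B = ∃ λ i → B ⊆ bag i

  -- Consecutive vertices of the walk share a bag, and the bags of a single vertex form a subtree;
  -- chaining these yields a tree walk through bags that meet `C`.
  hop : ∀ {C} {u v} → Walk (_∈ C) u v → ∀ {i j} → u ∈ bag i → v ∈ bag j →
        T.Walk (λ k → ∃ λ c → c ∈ C × c ∈ bag k) i j
  hop (stop u∈C) u∈i u∈j =
    T.walk-map (λ u∈ → _ , u∈C , u∈) (T.path→walk (proj₂ (coherent _) _ _ u∈i u∈j))
  hop (step u∈C a ω) u∈i v∈j = let k , u∈k , w∈k = edges _ _ a in
    T.walk-map (λ u∈ → _ , u∈C , u∈) (T.path→walk (proj₂ (coherent _) _ _ u∈i u∈k)) T.◅◅ hop ω w∈k v∈j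

  module _ {C : Subset (n G)} (C-conn : Conn C) {c : Vertex} (c∈C : c ∈ C) {z : Fin (n T)} (c∈z : c ∈ bag z) where

    Guarding : Fin (n T) → Set
    Guarding x = ∀ {w} → Boundary C w → w ∈ bag x

    Meets : Fin (n T) → Set
    Meets x = ∃ λ d → d ∈ C × d ∈ bag x

    -- Both the subtree of a boundary vertex w and the path towards z leave x by the same edge,
    -- for otherwise they would close a cycle through the bags that meet C.
    guarding-step : ∀ {x y ps} → ¬ Meets x → Guarding x → Linked (Adj T) (x ∷ y ∷ ps) →
                    Unique (x ∷ y ∷ ps) → last (y ∷ ps) ≡ just z → Guarding y
    guarding-step {x} {y} {ps} x∌C guarding (a ∷ as) (x≢ ∷ _) l {w} b@(_ , _ , d , d∈C , dw)
      with edges d w dw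
    ... | i , d∈i , w∈i with proj₂ (coherent w) x i (guarding b) w∈i
    ...   | x ∷ [] , _ , refl , refl = contradiction (d , d∈C , d∈i) x∌C
    ...   | x ∷ y′ ∷ ps′ , (a′ ∷ as′ , _ ∷ all′@(w∈y′ ∷ _) , x≢′ ∷ _) , refl , l′ =
      subst (λ k → w ∈ bag k) (≡-sym (T.tree-branch-unique (proj₂ tree) a a′ y⇝y′)) w∈y′
      where
      y⇝y′ : T.Walk (x ≢_) y y′
      y⇝y′ = T.list→walk ps as x≢ l
        T.◅◅ T.walk-map (λ { (e , e∈C , e∈k) refl → x∌C (e , e∈C , e∈k) }) (hop (C-conn c∈C d∈C) c∈z d∈i)
        T.◅◅ T.reverse (T.list→walk ps′ as′ x≢′ l′)

    -- Guarding is passed on along the tree path towards `z` until a bag meets `C`; this happens at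
    -- `z` at the latest, since `c` is in its bag.
    approach : ∀ {x} ps → Guarding x → Linked (Adj T) (x ∷ ps) → Unique (x ∷ ps) →
               last (x ∷ ps) ≡ just z → ∃ λ y → Guarding y × Meets y
    approach {x} ps guarding as uniq l with any? (λ d → (d ∈? C) ×-dec (d ∈? bag x))
    ... | yes meets = x , guarding , meets
    approach [] _ _ _ refl | no x∌C = contradiction (c , c∈C , c∈z) x∌C
    approach (y ∷ ps) guarding as@(_ ∷ as′) uniq@(_ ∷ uniq′) l | no x∌C =
      approach ps (guarding-step x∌C guarding as uniq l) as′ uniq′ l

  tree-separator : ∀ C → Region C → Anchored InBag C → Separator InBag C
  tree-separator C (_ , (c , c∈C) , C-conn) (B , (x , B⊆) , guards) with cover c
  ... | z , c∈z with proj₂ (proj₁ tree) x z tt tt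
  ...   | x ∷ ps , (as , _ , uniq) , refl , l
        with approach C-conn c∈C c∈z ps (λ b → B⊆ (guards b)) as uniq l
  ...     | y , guarding , d , d∈C , d∈y = record
    -- Cutting the bag down to `C` and its boundary secures `nearby` and loses no boundary vertex.
    { bag = bag y ∩ comprehension near?
    ; small = y , p∩q⊆p _ _
    ; guards = λ b → x∈p∩q⁺ (guarding b , ∈-comprehension⁺ near? (inj₂ b))
    ; nearby = λ w∈ → ∈-comprehension⁻ near? (p∩q⊆q (bag y) _ w∈)
    ; advance = d , d∈C , x∈p∩q⁺ (d∈y , ∈-comprehension⁺ near? (inj₁ d∈C)) }
    where
    near? : Decidable (λ w → w ∈ C ⊎ Boundary C w)
    near? w = (w ∈? C) ⊎-dec boundary? C w

-- Edges as separators for h = 0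

module CliqueSeparators (G : Graph) (U : Subset (n G)) (U-nonempty : Nonempty U) (U-conn : Walks.Conn G U) where
  open Walks G
  open Regions G U

  -- Smaller cliques count as well: the empty set anchors the start, and a single vertex serves when
  -- the boundary is empty.
  Edge : Subset (n G) → Set
  Edge B = ∣ B ∣ ≤ 2 × (∀ {a b} → a ∈ B → b ∈ B → a ≢ b → Adj G a b)

  edge-∅ : Edge ∅
  edge-∅ = ℕ.≤-trans (ℕ.≤-reflexive (∣⊥∣≡0 (n G))) z≤n , λ a∈ → contradiction a∈ ∉⊥

  edge-pair : ∀ {a d} → Adj G a d → Edge (⁅ a ⁆ ∪ ⁅ d ⁆)
  edge-pair {a} {d} ad =
    ℕ.≤-trans (∣p∪q∣≤∣p∣+∣q∣ ⁅ a ⁆ ⁅ d ⁆) (ℕ.≤-reflexive (≡-sym (2≡ a d))) ,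
    λ {x} {y} x∈ y∈ x≢y → pair (members x∈) (members y∈) x≢y
    where
    2≡ : ∀ a d → 2 ≡ ∣ ⁅ a ⁆ ∣ + ∣ ⁅ d ⁆ ∣
    2≡ a d rewrite ∣⁅x⁆∣≡1 a | ∣⁅x⁆∣≡1 d = refl
    members : ∀ {x} → x ∈ ⁅ a ⁆ ∪ ⁅ d ⁆ → x ≡ a ⊎ x ≡ d
    members x∈ = Sum.map (x∈⁅y⁆⇒x≡y a) (x∈⁅y⁆⇒x≡y d) (x∈p∪q⁻ ⁅ a ⁆ ⁅ d ⁆ x∈)
    pair : ∀ {x y} → x ≡ a ⊎ x ≡ d → y ≡ a ⊎ y ≡ d → x ≢ y → Adj G x y
    pair (inj₁ refl) (inj₁ refl) x≢y = contradiction refl x≢y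
    pair (inj₁ refl) (inj₂ refl) _ = ad
    pair (inj₂ refl) (inj₁ refl) _ = Adj-sym ad
    pair (inj₂ refl) (inj₂ refl) x≢y = contradiction refl x≢y

  edge-singleton : ∀ d → Edge ⁅ d ⁆
  edge-singleton d = ℕ.≤-trans (ℕ.≤-reflexive (∣⁅x⁆∣≡1 d)) (s≤s z≤n) ,
    λ a∈ b∈ a≢b → contradiction (trans (x∈⁅y⁆⇒x≡y d a∈) (≡-sym (x∈⁅y⁆⇒x≡y d b∈))) a≢b

  -- The singletons of `a` and `b` together with `C` form the structure; each link is a single edge.
  triangle : ∀ {C} → Region C → ∀ {a b} → Boundary C a → Boundary C b → a ≢ b → Adj G a b → InT 1 G U
  triangle {C} (C⊆U , C-ne , C-conn) {a} {b} (a∈U , a∉C , d , d∈C , da) (b∈U , b∉C , e , e∈C , eb) a≢b ab =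
    connectedIn U-nonempty U-conn , ⁅ a ⁆ , ⁅ b ⁆ , C ,
    (⊆U a∈U , ⊆U b∈U , C⊆U) ,
    ( (λ (x , x∈) → let x∈a , x∈b = x∈p∩q⁻ ⁅ a ⁆ ⁅ b ⁆ x∈ in
        a≢b (trans (≡-sym (x∈⁅y⁆⇒x≡y a x∈a)) (x∈⁅y⁆⇒x≡y b x∈b)))
    , apart a∉C , apart b∉C) ,
    (point a , point b , connectedIn C-ne C-conn) ,
    (a , b , x∈⁅x⁆ a , x∈⁅x⁆ b , walk→path (step (a∈U , a∉C) ab (stop (b∈U , b∉C)))) ,
    (a , d , x∈⁅x⁆ a , d∈C , walk→path (step (a∈U , x≢y⇒x∉⁅y⁆ a≢b) (Adj-sym da) (stop (C⊆U d∈C , outside-C b∉C d∈C)))) ,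
    (b , e , x∈⁅x⁆ b , e∈C , walk→path (step (b∈U , x≢y⇒x∉⁅y⁆ (a≢b ∘ ≡-sym)) (Adj-sym eb) (stop (C⊆U e∈C , outside-C a∉C e∈C))))
    where
    ⊆U : ∀ {a} → a ∈ U → ⁅ a ⁆ ⊆ U
    ⊆U {a} a∈U x∈ = subst (_∈ U) (≡-sym (x∈⁅y⁆⇒x≡y a x∈)) a∈U
    outside-C : ∀ {a x} → a ∉ C → x ∈ C → x ∉ ⁅ a ⁆
    outside-C {a} a∉C x∈C x∈a = a∉C (subst (_∈ C) (x∈⁅y⁆⇒x≡y a x∈a) x∈C)
    apart : ∀ {a} → a ∉ C → ¬ Nonempty (⁅ a ⁆ ∩ C)
    apart {a} a∉C (x , x∈) = let x∈a , x∈C = x∈p∩q⁻ ⁅ a ⁆ C x∈ in outside-C a∉C x∈C x∈a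
    point : ∀ a → ConnectedIn G (_∈ ⁅ a ⁆)
    point a = connectedIn (a , x∈⁅x⁆ a) λ {u} u∈ v∈ →
      subst (Walk _ u) (trans (x∈⁅y⁆⇒x≡y a u∈) (≡-sym (x∈⁅y⁆⇒x≡y a v∈))) (stop u∈)

  -- Two boundary vertices would both lie in `B` and be adjacent, which gives the structure above. A
  -- sole boundary vertex is paired with a neighbour in `C`, and without boundary any vertex of `C`
  -- will do.
  edge-separator : ∀ C → Region C → Anchored Edge C → InT 1 G U ⊎ Separator Edge C
  edge-separator C rC@(C⊆U , (c , c∈C) , _) (B , (_ , clique) , guards) with any? (boundary? C)
  ... | no isolated = inj₂ record
    { bag = ⁅ c ⁆
    ; small = edge-singleton c
    ; guards = λ {w} b → contradiction (w , b) isolated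
    ; nearby = λ w∈ → inj₁ (subst (_∈ C) (≡-sym (x∈⁅y⁆⇒x≡y c w∈)) c∈C)
    ; advance = c , c∈C , x∈⁅x⁆ c }
  ... | yes (a , ba@(_ , _ , d , d∈C , da)) with any? (λ b → boundary? C b ×-dec ¬? (a ≟ b))
  ...   | yes (b , bb , a≢b) = inj₁ (triangle rC ba bb a≢b (clique (guards ba) (guards bb) a≢b))
  ...   | no unique = inj₂ record
    { bag = ⁅ a ⁆ ∪ ⁅ d ⁆
    ; small = edge-pair (Adj-sym da)
    ; guards = λ {w} bw → case a ≟ w of λ where
        (yes refl) → p⊆p∪q ⁅ d ⁆ (x∈⁅x⁆ a)
        (no a≢w) → contradiction (w , bw , a≢w) unique
    ; nearby = λ w∈ → case x∈p∪q⁻ ⁅ a ⁆ ⁅ d ⁆ w∈ of λ where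
        (inj₁ w∈a) → inj₂ (subst (Boundary C) (≡-sym (x∈⁅y⁆⇒x≡y a w∈a)) ba)
        (inj₂ w∈d) → inj₁ (subst (_∈ C) (≡-sym (x∈⁅y⁆⇒x≡y d w∈d)) d∈C)
    ; advance = d , d∈C , q⊆p∪q ⁅ a ⁆ ⁅ d ⁆ (x∈⁅x⁆ d) }

-- Induction on h

module _ (G : Graph) (t : ℕ) (D : TreeDecomposition G) (width : ∀ i → ∣ TreeDecomposition.bag D i ∣ ≤ t) where
  open Walks G
  open Regions G

  -- The bound counts bag sizes: it starts at 2, the size of an edge, and each level adds at most
  -- `t` vertices of a tree bag to the bags of the light pieces.
  sweep⊎InT : ∀ h U → Nonempty U → Conn U → InT (suc h) G U ⊎ Light U (t * h + 2) U
  sweep⊎InT zero U ne conn =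
    subst (λ k → InT 1 G U ⊎ Light U k U) (cong (_+ 2) (≡-sym (ℕ.*-zeroʳ t)))
      (Backbone.sweep G 0 2 0 U ne conn Edge proj₁ (∅ , edge-∅) edge-separator
        -- A region is nonempty and connected, hence in the lowest class: no piece is classified as
        -- light, and `ℓ` can be 0.
        (λ C (_ , C-ne , C-conn) → inj₁ (connectedIn C-ne C-conn)))
    where open CliqueSeparators G U ne conn
  sweep⊎InT (suc h) U ne conn =
    subst (λ k → InT (suc (suc h)) G U ⊎ Light U k U)
      (trans (≡-sym (ℕ.+-assoc t (t * h) 2)) (cong (_+ 2) (≡-sym (ℕ.*-suc t h))))
      (Backbone.sweep G (suc h) t (t * h + 2) U ne conn InBag
        (λ (i , B⊆) → ℕ.≤-trans (p⊆q⇒∣p∣≤∣q∣ B⊆) (width i))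
        (∅ , proj₁ (proj₁ (proj₁ (TreeDecomposition.tree D))) , ⊥⊆)
        (λ C rC anch → inj₂ (tree-separator C rC anch))
        (λ C (_ , C-ne , C-conn) → sweep⊎InT h C C-ne C-conn))
    where open TreeSeparators G D U

theorem7 : (t : ℕ) → 1 ≤ t → (h : ℕ) → (G : Graph) →
    Connected G → TreewidthAtMost G (t ∸ 1) →
    PathwidthAtMost G (t * h + 1) ⊎ InClassT (suc h) G
theorem7 (suc t) _ h G ((v , _) , paths) (D , width)
  with sweep⊎InT G (suc t) D width h (V G) (v , ∈⊤)
         (λ {x} {y} _ _ → Walks.walk-map G (λ _ → ∈⊤) (Walks.path→walk G (paths x y tt tt)))
... | inj₁ inT = inj₂ inT
-- Width is bag size minus one, so `suc t * h + 2` is rewritten as the successor of the claimed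
-- width.
... | inj₂ S = inj₁ (Sweeps.sweep→pathwidth G (subst (λ k → Regions.Light G (V G) k (V G)) (ℕ.+-suc (suc t * h) 1) S))
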